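{- There exists an absolute constant $C$ such that for all positive integers $n,t$, every $t$-degenerate bipartite graph $H$ on $n$ vertices satisfies $ER(H)\le n^{Ct}$.
   Context: A graph is $t$-degenerate if its vertices can be ordered so that each vertex has at most $t$ neighbors preceding it. Edge-colorings of $K_N$ may use arbitrarily many colors. A copy of $H$ in $K_N$ (injective $\varphi:V(H)\to V(K_N)$) is canonically colored if it is monochromatic (all edges same color), rainbow (all edges distinct colors), or lexicographic: there is an ordering $v_1,\dots,v_n$ of $V(H)$ such that for each $i$ all edges $\varphi(v_i)\varphi(v_j)$ with $v_iv_j\in E(H)$, $j>i$, have the same color $c_i$, and these colors are distinct for different $v_i$. $ER(H)$ is the least $N$ such that every edge-coloring of $K_N$ contains a canonically colored copy of $H$. -}

module Defs where

open import Data.Nat using (ℕ; zero; suc; _+_; _≤_)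
open import Data.Fin using (Fin; _<_)
open import Data.Bool using (Bool; true; false; if_then_else_; _∧_)
open import Data.List using (List; map; allFin)
open import Data.Nat.ListAction using (sum)
open import Data.Product using (Σ; ∃; _×_; _,_)
open import Data.Sum using (_⊎_)
open import Relation.Binary.PropositionalEquality using (_≡_; _≢_)
open import Function.Definitions using (Injective)

record Graph (n : ℕ) : Set where
  field
    Adj    : Fin n → Fin n → Bool
    sym    : ∀ i j → Adj i j ≡ Adj j i
    irrefl : ∀ i → Adj i i ≡ false
open Graph public

Edge : ∀ {n} → Graph n → Fin n → Fin n → Set
Edge H i j = Adj H i j ≡ true

count : ∀ {n} → (Fin n → Bool) → ℕ
count {n} p = sum (map (λ u → if p u then 1 else 0) (allFin n))

Bipartite : ∀ {n} → Graph n → Set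
Bipartite {n} H = Σ (Fin n → Bool) λ side → ∀ i j → Edge H i j → side i ≢ side j

-- An ordering of the vertices: vertex v is placed at position pos v
-- (pos injective, hence a bijection Fin n → Fin n).
Ordering : ℕ → Set
Ordering n = Σ (Fin n → Fin n) λ pos → Injective _≡_ _≡_ pos

_<ᵇ_ : ∀ {n} → Fin n → Fin n → Bool
i <ᵇ j = Data.Nat._<ᵇ_ (Data.Fin.toℕ i) (Data.Fin.toℕ j)
  where import Data.Nat; import Data.Fin

Degenerate : ℕ → ∀ {n} → Graph n → Set
Degenerate t {n} H = Σ (Ordering n) λ { (pos , _) →
  ∀ v → count (λ u → Adj H u v ∧ (pos u <ᵇ pos v)) ≤ t }

-- An edge-colouring of K_N with arbitrarily many colours (colours are
-- natural numbers); only the values at distinct pairs matter.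
Colouring : ℕ → Set
Colouring N = Σ (Fin N → Fin N → ℕ) λ c → ∀ x y → c x y ≡ c y x

Copy : ℕ → ℕ → Set
Copy n N = Σ (Fin n → Fin N) λ φ → Injective _≡_ _≡_ φ

module _ {n N : ℕ} (H : Graph n) (c : Fin N → Fin N → ℕ) (φ : Fin n → Fin N) where

  Monochromatic : Set
  Monochromatic = ∃ λ (col : ℕ) → ∀ i j → Edge H i j → c (φ i) (φ j) ≡ col

  Rainbow : Set
  Rainbow = ∀ i j k l → Edge H i j → Edge H k l →
            c (φ i) (φ j) ≡ c (φ k) (φ l) →
            (i ≡ k × j ≡ l) ⊎ (i ≡ l × j ≡ k)

  Lexicographic : Set
  Lexicographic = Σ (Ordering n) λ { (pos , _) →
    Σ (Fin n → ℕ) λ col → Injective _≡_ _≡_ col ×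
      (∀ i j → Edge H i j → pos i < pos j → c (φ i) (φ j) ≡ col i) }

  Canonical : Set
  Canonical = Monochromatic ⊎ Rainbow ⊎ Lexicographic

-- Every edge-colouring of K_N contains a canonically coloured copy of H.
-- ER(H) is the least N with this property.
ERProperty : ∀ {n} → Graph n → ℕ → Set
ERProperty {n} H N = (c : Colouring N) →
  Σ (Copy n N) λ φ → Canonical H (Data.Product.proj₁ c) (Data.Product.proj₁ φ)
  where import Data.Product

-- ER(H) ≤ M  :⇔  some N ≤ M has the property (since ER(H) is the least such N).
ER≤ : ∀ {n} → Graph n → ℕ → Set
ER≤ H M = ∃ λ N → N ≤ M × ERProperty H N

{-# OPTIONS --safe #-}

-- Call a vertex x heavy if some colour, dominant x, is carried by at least an n⁻¹⁶
-- fraction of the pairs at x.  If there are K² heavy vertices, choose a set X of K of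
-- them whose dominant colours are all equal or all distinct.  Two rounds of dependent
-- random choice in the dense bipartite relation c x y ≡ dominant x (x ∈ X) yield a pair
-- of vertex sets into which H embeds greedily along its degeneracy order; the copy is
-- monochromatic, or lexicographic with the side lying in X listed first.  Otherwise at
-- least half of the vertices are light, and a rainbow Kₙ is built greedily among them:
-- light centres carry few pairs c y u ≡ c y v, so the vertices u that are in many such
-- cherries with many v can be discarded.

module Submission where

open import Defs hiding (sym)
open import Data.Nat using (ℕ; zero; suc; _+_; _*_; _^_; _∸_; _≤_; _<_; z≤n; s≤s; _≤?_; _<?_; >-nonZero)
open import Data.Nat.Properties
open import Data.Nat.ListAction using (sum)
open import Data.Nat.Tactic.RingSolver using (solve-∀)
open import Data.Bool using (Bool; true; false; not; T; if_then_else_; _∧_)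
open import Data.Bool.Properties using (T?; T-∧; T-≡; ¬-not)
open import Data.Fin using (Fin; zero; suc; toℕ; fromℕ<)
import Data.Fin.Properties as Fin
open import Data.List using (List; []; _∷_; _++_; map; length; filter; concatMap; allFin; take; replicate)
open import Data.List.Properties using (length-map; length-++; length-filter; length-tabulate; length-take; length-replicate)
open import Data.List.Relation.Unary.Any as Any using (Any; here; there; any?)
open import Data.List.Relation.Unary.All as All using (All; []; _∷_; all?)
import Data.List.Relation.Unary.All.Properties as All
open import Data.List.Relation.Unary.AllPairs as AllPairs using (AllPairs; []; _∷_)
open import Data.List.Relation.Unary.Unique.Propositional using (Unique)
import Data.List.Relation.Unary.Unique.Propositional.Properties as Unique
open import Data.List.Membership.Propositional using (_∈_; _∉_; lose)
open import Data.List.Membership.Propositional.Properties using (∈-filter⁻; ∈-filter⁺; ∈-map⁺; ∈-++⁺ˡ; ∈-++⁺ʳ; ∈-allFin)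
open import Data.Product as Product using (Σ; ∃; ∃₂; _×_; _,_; proj₁; proj₂)
open import Data.Sum as Sum using (_⊎_; inj₁; inj₂)
open import Data.Empty using (⊥-elim)
open import Data.Unit using (⊤; tt)
open import Function using (_∘_; id)
open import Function.Bundles using (Equivalence)
open import Function.Definitions using (Injective)
open import Level using (0ℓ)
open import Relation.Nullary using (¬_; Dec; yes; no; does; contradiction)
open import Relation.Nullary.Decidable using (_⊎-dec_; _×-dec_; ¬?)
open import Relation.Unary using (Pred; Decidable)
open import Relation.Binary.Definitions using (DecidableEquality; tri<; tri≈; tri>)
open import Relation.Binary.PropositionalEquality using (_≡_; _≢_; refl; sym; trans; cong; cong₂; subst; subst₂)

private variable
  A B C : Set
  P Q : Pred A 0ℓ

-- Finite sums and counts over lists, with averaging, union bound and Markov's inequality.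

∑ : (A → ℕ) → List A → ℕ
∑ f xs = sum (map f xs)

indicator : {X : Set} → Dec X → ℕ
indicator d = if does d then 1 else 0

# : {P : Pred A 0ℓ} → Decidable P → List A → ℕ
# P? = ∑ (λ x → indicator (P? x))

∑-mono : ∀ {f g : A → ℕ} xs → (∀ {x} → x ∈ xs → f x ≤ g x) → ∑ f xs ≤ ∑ g xs
∑-mono []       h = z≤n
∑-mono (x ∷ xs) h = +-mono-≤ (h (here refl)) (∑-mono xs (h ∘ there))

∑-const : ∀ k (xs : List A) → ∑ (λ _ → k) xs ≡ length xs * k
∑-const k []       = refl
∑-const k (x ∷ xs) = cong (k +_) (∑-const k xs)

∑-+ : ∀ (f g : A → ℕ) xs → ∑ (λ x → f x + g x) xs ≡ ∑ f xs + ∑ g xs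
∑-+ f g []       = refl
∑-+ f g (x ∷ xs) rewrite ∑-+ f g xs = interchange (f x) (g x) (∑ f xs) (∑ g xs)
  where
  interchange : ∀ a b c d → a + b + (c + d) ≡ a + c + (b + d)
  interchange = solve-∀

∑-*ˡ : ∀ k (f : A → ℕ) xs → ∑ (λ x → k * f x) xs ≡ k * ∑ f xs
∑-*ˡ k f []       = sym (*-zeroʳ k)
∑-*ˡ k f (x ∷ xs) = trans (cong (k * f x +_) (∑-*ˡ k f xs)) (sym (*-distribˡ-+ k _ _))

∑-*ʳ : ∀ k (f : A → ℕ) xs → ∑ (λ x → f x * k) xs ≡ ∑ f xs * k
∑-*ʳ k f []       = refl
∑-*ʳ k f (x ∷ xs) = trans (cong (f x * k +_) (∑-*ʳ k f xs)) (sym (*-distribʳ-+ k (f x) _))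

∑-swap : ∀ (f : A → B → ℕ) xs ys →
         ∑ (λ x → ∑ (f x) ys) xs ≡ ∑ (λ y → ∑ (λ x → f x y) xs) ys
∑-swap f []       ys = sym (trans (∑-const 0 ys) (*-zeroʳ (length ys)))
∑-swap f (x ∷ xs) ys =
  trans (cong (∑ (f x) ys +_) (∑-swap f xs ys)) (sym (∑-+ (f x) _ ys))

∑-≤-const : ∀ {f : A → ℕ} {k} xs → (∀ {x} → x ∈ xs → f x ≤ k) → ∑ f xs ≤ length xs * k
∑-≤-const {k = k} xs h = ≤-trans (∑-mono xs h) (≤-reflexive (∑-const k xs))

∑-≥-const : ∀ {f : A → ℕ} {k} xs → (∀ {x} → x ∈ xs → k ≤ f x) → length xs * k ≤ ∑ f xs
∑-≥-const {k = k} xs h = ≤-trans (≤-reflexive (sym (∑-const k xs))) (∑-mono xs h)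

∑-pick : ∀ (f g : A → ℕ) {xs} → 1 ≤ length xs → ∑ f xs ≤ ∑ g xs → ∃ λ x → x ∈ xs × f x ≤ g x
∑-pick f g {x ∷ xs} _ h with f x ≤? g x
... | yes p = x , here refl , p
... | no ¬p = continue xs h
  where
  continue : ∀ ys → f x + ∑ f ys ≤ g x + ∑ g ys → ∃ λ y → y ∈ x ∷ ys × f y ≤ g y
  continue []       h = contradiction (+-cancelʳ-≤ 0 (f x) (g x) h) ¬p
  continue (y ∷ ys) h =
    let y′ , y′∈ , le = ∑-pick f g (s≤s z≤n)
                          (<⇒≤ (+-cancelˡ-< (g x) _ _ (<-≤-trans (+-monoˡ-< _ (≰⇒> ¬p)) h)))
    in y′ , there y′∈ , le

indicator-mono : {X Y : Set} (d : Dec X) (e : Dec Y) → (X → Y) → indicator d ≤ indicator e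
indicator-mono (no  _) e       f = z≤n
indicator-mono (yes x) (yes y) f = s≤s z≤n
indicator-mono (yes x) (no ¬y) f = contradiction (f x) ¬y

#-mono : (P? : Decidable P) (Q? : Decidable Q) (xs : List A) →
         (∀ {x} → x ∈ xs → P x → Q x) → # P? xs ≤ # Q? xs
#-mono P? Q? xs h = ∑-mono xs λ {x} x∈ → indicator-mono (P? x) (Q? x) (h x∈)

#-filter : (P? : Decidable P) (xs : List A) → # P? xs ≡ length (filter P? xs)
#-filter P? []       = refl
#-filter P? (x ∷ xs) with P? x
... | yes _ = cong suc (#-filter P? xs)
... | no  _ = #-filter P? xs

#-filter-× : (P? : Decidable P) (Q? : Decidable Q) (xs : List A) →
             # Q? (filter P? xs) ≡ # (λ x → P? x ×-dec Q? x) xs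
#-filter-× P? Q? []       = refl
#-filter-× P? Q? (x ∷ xs) with P? x
... | yes _ = cong (indicator (Q? x) +_) (#-filter-× P? Q? xs)
... | no  _ = #-filter-× P? Q? xs

#≤length : (P? : Decidable P) (xs : List A) → # P? xs ≤ length xs
#≤length P? xs = ≤-trans (≤-reflexive (#-filter P? xs)) (length-filter P? xs)

#-⊎ : (P? : Decidable P) (Q? : Decidable Q) (xs : List A) →
      # (λ x → P? x ⊎-dec Q? x) xs ≤ # P? xs + # Q? xs
#-⊎ P? Q? xs = ≤-trans
  (∑-mono xs λ {x} _ → bound (P? x) (Q? x))
  (≤-reflexive (∑-+ (λ x → indicator (P? x)) (λ x → indicator (Q? x)) xs))
  where
  bound : {X Y : Set} (d : Dec X) (e : Dec Y) → indicator (d ⊎-dec e) ≤ indicator d + indicator e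
  bound (yes _) e       = s≤s z≤n
  bound (no  _) (yes _) = s≤s z≤n
  bound (no  _) (no  _) = z≤n

#-complement : (P? : Decidable P) (xs : List A) → # P? xs + # (λ x → ¬? (P? x)) xs ≡ length xs
#-complement P? []       = refl
#-complement P? (x ∷ xs) with P? x
... | yes _ = cong suc (#-complement P? xs)
... | no  _ = trans (+-suc _ _) (cong suc (#-complement P? xs))

#-none : (P? : Decidable P) {xs : List A} → (∀ {x} → x ∈ xs → ¬ P x) → # P? xs ≡ 0
#-none P? {[]}     h = refl
#-none P? {x ∷ xs} h with P? x
... | yes p = contradiction p (h (here refl))
... | no  _ = #-none P? (h ∘ there)

#≡0⇒none : (P? : Decidable P) {xs : List A} → # P? xs ≡ 0 → ∀ {x} → x ∈ xs → ¬ P x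
#≡0⇒none P? {y ∷ xs} e x∈ p with P? y | x∈
... | no ¬p | here refl = ¬p p
... | no  _ | there x∈′ = #≡0⇒none P? e x∈′ p

#-witness : (P? : Decidable P) {xs : List A} → 1 ≤ # P? xs → ∃ λ x → x ∈ xs × P x
#-witness P? {x ∷ xs} h with P? x
... | yes p = x , here refl , p
... | no  _ = let y , y∈ , p = #-witness P? h in y , there y∈ , p

#-any : {R : B → A → Set} (R? : ∀ z → Decidable (R z)) (zs : List B) (xs : List A) {k : ℕ} →
        (∀ {z} → z ∈ zs → # (R? z) xs ≤ k) → # (λ x → any? (λ z → R? z x) zs) xs ≤ length zs * k
#-any R? []       xs h = ≤-reflexive (#-none (λ x → any? (λ z → R? z x) []) {xs} λ _ ())
#-any {R = R} R? (z ∷ zs) xs h = ≤-trans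
  (#-mono (λ x → any? (λ z → R? z x) (z ∷ zs)) (λ x → R? z x ⊎-dec any? (λ z → R? z x) zs) xs
          λ _ → λ { (here r) → inj₁ r ; (there r) → inj₂ r })
  (≤-trans (#-⊎ (R? z) (λ x → any? (λ z → R? z x) zs) xs)
           (+-mono-≤ (h (here refl)) (#-any R? zs xs (h ∘ there))))

#-≡ : (_≟_ : DecidableEquality A) (z : A) {xs : List A} → Unique xs → # (z ≟_) xs ≤ 1
#-≡ _≟_ z []        = z≤n
#-≡ _≟_ z {x ∷ _} (x∉ ∷ u) with z ≟ x
... | no  _    = #-≡ _≟_ z u
... | yes refl = s≤s (≤-reflexive (#-none (z ≟_) λ y∈ z≡y → All.lookup x∉ y∈ z≡y))

#-∈ : (_≟_ : DecidableEquality A) (zs : List A) {xs : List A} → Unique xs →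
      # (λ x → any? (λ z → z ≟ x) zs) xs ≤ length zs
#-∈ _≟_ zs {xs} u =
  ≤-trans (#-any (λ z x → z ≟ x) zs xs λ {z} _ → #-≡ _≟_ z u) (≤-reflexive (*-identityʳ _))

#-avoid : (P? : Decidable P) (Q? : Decidable Q) {xs : List A} →
          # Q? xs < # P? xs → ∃ λ x → x ∈ xs × P x × ¬ Q x
#-avoid P? Q? {xs} h =
  let x , x∈ , p , ¬q = #-witness R? (≰⇒> λ z → <⇒≱ h (≤-trans (≤-trans cover (#-⊎ Q? R? xs))
                          (≤-trans (+-monoʳ-≤ _ z) (≤-reflexive (+-identityʳ _)))))
  in x , x∈ , p , ¬q
  where
  R? = λ x → P? x ×-dec ¬? (Q? x)
  cover : # P? xs ≤ # (λ x → Q? x ⊎-dec R? x) xs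
  cover = #-mono P? (λ x → Q? x ⊎-dec R? x) xs λ {x} _ p → split (Q? x) p
    where
    split : ∀ {X Y : Set} → Dec Y → X → Y ⊎ (X × ¬ Y)
    split (yes y) _ = inj₁ y
    split (no ¬y) x = inj₂ (x , ¬y)

markov : (f : A → ℕ) (k : ℕ) (xs : List A) → # (λ x → k ≤? f x) xs * k ≤ ∑ f xs
markov f k xs = ≤-trans (≤-reflexive (sym (∑-*ʳ k (λ x → indicator (k ≤? f x)) xs)))
                       (∑-mono xs λ {x} _ → bound (k ≤? f x))
  where
  bound : ∀ {m} (d : Dec (k ≤ m)) → indicator d * k ≤ m
  bound (yes p) = ≤-trans (≤-reflexive (+-identityʳ k)) p
  bound (no  _) = z≤n

-- Tuples with repetition, and dependent random choice.

tuples : ℕ → List A → List (List A)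
tuples zero    xs = [] ∷ []
tuples (suc k) xs = concatMap (λ x → map (x ∷_) (tuples k xs)) xs

length-tuples : ∀ k (xs : List A) → length (tuples k xs) ≡ length xs ^ k
length-tuples zero    xs = refl
length-tuples (suc k) xs = go xs
  where
  go : ∀ ys → length (concatMap (λ x → map (x ∷_) (tuples k xs)) ys) ≡ length ys * length xs ^ k
  go []       = refl
  go (y ∷ ys) = trans (length-++ (map (y ∷_) (tuples k xs)))
    (cong₂ _+_ (trans (length-map _ (tuples k xs)) (length-tuples k xs)) (go ys))

∈-tuples : ∀ {zs xs : List A} → All (_∈ xs) zs → zs ∈ tuples (length zs) xs
∈-tuples []                 = here refl
∈-tuples {zs = z ∷ zs} {xs} (z∈ ∷ zs∈) = go xs z∈
  where
  go : ∀ ys → z ∈ ys → (z ∷ zs) ∈ concatMap (λ x → map (x ∷_) (tuples (length zs) xs)) ys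
  go (y ∷ ys) (here refl) = ∈-++⁺ˡ (∈-map⁺ (z ∷_) (∈-tuples zs∈))
  go (y ∷ ys) (there z∈)  = ∈-++⁺ʳ _ (go ys z∈)

-- Dependent random choice: T is built one element at a time, keeping the number of as
-- adjacent to all of T minus w times the number of such bs at least at its average.
dependentChoice : {R : A → C → Set} {S : B → C → Set} (R? : ∀ a → Decidable (R a)) (S? : ∀ b → Decidable (S b))
      (w : ℕ) {d m : ℕ} {ys : List C} → 1 ≤ length ys → ∀ s (as : List A) (bs : List B) →
      (∀ {a} → a ∈ as → d ≤ # (R? a) ys) → (∀ {b} → b ∈ bs → # (S? b) ys ≤ m) →
      ∃ λ T → length T ≡ s × All (_∈ ys) T ×
        length as * d ^ s + length ys ^ s * (w * # (λ b → all? (S? b) T) bs)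
          ≤ length ys ^ s * # (λ a → all? (R? a) T) as + w * (length bs * m ^ s)
dependentChoice R? S? w ne zero as bs hR hS = [] , refl , [] , ≤-reflexive (cong₂ _+_ eqR eqS)
  where
  full : ∀ {A : Set} (zs : List A) → # (λ _ → yes tt) zs ≡ length zs
  full []       = refl
  full (z ∷ zs) = cong suc (full zs)
  eqR : length as * 1 ≡ 1 * # (λ a → all? (R? a) []) as
  eqR = trans (*-identityʳ _) (trans (sym (full as)) (sym (*-identityˡ _)))
  eqS : 1 * (w * # (λ b → all? (S? b) []) bs) ≡ w * (length bs * 1)
  eqS = trans (*-identityˡ _) (cong (w *_) (trans (full bs) (sym (*-identityʳ _))))
dependentChoice {R = R} {S = S} R? S? w {d} {m} {ys} ne (suc s) as bs hR hS =
  let y , y∈ , hy = ∑-pick F G {ys} ne average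
      T , len , T∈ , h = dependentChoice R? S? w {ys = ys} ne s (filter (λ a → R? a y) as) (filter (λ b → S? b y) bs)
                             (hR ∘ proj₁ ∘ ∈-filter⁻ (λ a → R? a y)) (hS ∘ proj₁ ∘ ∈-filter⁻ (λ b → S? b y))
  in y ∷ T , cong suc len , y∈ ∷ T∈ ,
     combine (length as * d ^ suc s) _ (β y) _ _ _ hy
       (subst₂ (λ a b → a * d ^ s + N ^ s * (w * # (λ b → all? (S? b) T) (filter (λ b → S? b y) bs))
                       ≤ N ^ s * # (λ a → all? (R? a) T) (filter (λ a → R? a y) as) + w * (b * m ^ s))
          (sym (#-filter (λ a → R? a y) as)) (sym (#-filter (λ b → S? b y) bs)) h)
       (#-filter-× (λ a → R? a y) (λ a → all? (R? a) T) as)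
       (#-filter-× (λ b → S? b y) (λ b → all? (S? b) T) bs)
  where
  N = length ys
  α = λ y → # (λ a → R? a y) as
  β = λ y → # (λ b → S? b y) bs
  -- Without subtraction, `F y ≤ G y` says that `N * (α y * d ^ s - w * β y * m ^ s)` is at least
  -- `length as * d ^ suc s - w * length bs * m ^ suc
  -- s`. Double counting adjacent pairs (`∑α`, `∑β`) gives this on average over `ys`.
  F = λ y → length as * d ^ suc s + N * (w * (β y * m ^ s))
  G = λ y → N * (α y * d ^ s) + w * (length bs * m ^ suc s)
  ∑α : length as * d ≤ ∑ α ys
  ∑α = ≤-trans (∑-≥-const as hR) (≤-reflexive (∑-swap (λ a y → indicator (R? a y)) as ys))
  ∑β : ∑ β ys ≤ length bs * m
  ∑β = ≤-trans (≤-reflexive (sym (∑-swap (λ b y → indicator (S? b y)) bs ys))) (∑-≤-const bs hS)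
  ∑F : ∑ F ys ≡ N * (length as * d ^ suc s) + N * (w * (∑ β ys * m ^ s))
  ∑F = trans (∑-+ (λ _ → length as * d ^ suc s) (λ y → N * (w * (β y * m ^ s))) ys)
    (cong₂ _+_ (∑-const _ ys) (trans (∑-*ˡ N (λ y → w * (β y * m ^ s)) ys)
      (cong (N *_) (trans (∑-*ˡ w (λ y → β y * m ^ s) ys) (cong (w *_) (∑-*ʳ (m ^ s) β ys))))))
  ∑G : ∑ G ys ≡ N * (∑ α ys * d ^ s) + N * (w * (length bs * m ^ suc s))
  ∑G = trans (∑-+ (λ y → N * (α y * d ^ s)) (λ _ → w * (length bs * m ^ suc s)) ys)
    (cong₂ _+_ (trans (∑-*ˡ N (λ y → α y * d ^ s) ys) (cong (N *_) (∑-*ʳ (d ^ s) α ys))) (∑-const _ ys))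
  average : ∑ F ys ≤ ∑ G ys
  average = ≤-trans (≤-reflexive ∑F) (≤-trans
    (+-mono-≤
      (*-monoʳ-≤ N (≤-trans (≤-reflexive (sym (*-assoc (length as) d (d ^ s)))) (*-monoˡ-≤ (d ^ s) ∑α)))
      (*-monoʳ-≤ N (*-monoʳ-≤ w (≤-trans (*-monoˡ-≤ (m ^ s) ∑β) (≤-reflexive (*-assoc (length bs) m (m ^ s)))))))
    (≤-reflexive (sym ∑G)))
  combine : ∀ a b₁ b′ a′ z₁ z₂ {z₁′ z₂′} → a + N * (w * (b′ * m ^ s)) ≤ N * a′ + b₁ →
    a′ + N ^ s * (w * z₂) ≤ N ^ s * z₁ + w * (b′ * m ^ s) → z₁ ≡ z₁′ → z₂ ≡ z₂′ →
    a + N ^ suc s * (w * z₂′) ≤ N ^ suc s * z₁′ + b₁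
  -- `N` times the inductive inequality is added to `hy`; the terms in `a′` and `b′` then stand on
  -- both sides and cancel.
  combine a b₁ b′ a′ z₁ z₂ hy h refl refl =
    +-cancelʳ-≤ (N * a′ + N * (w * (b′ * m ^ s))) _ _
      (subst₂ _≤_ (lhs a b′ a′ z₂ (N ^ s) (m ^ s) N w) (rhs b₁ b′ a′ z₁ (N ^ s) (m ^ s) N w) (+-mono-≤ hy (*-monoʳ-≤ N h)))
    where
    lhs : ∀ a b′ a′ z₂ Ns ms N w → a + N * (w * (b′ * ms)) + N * (a′ + Ns * (w * z₂))
          ≡ a + N * Ns * (w * z₂) + (N * a′ + N * (w * (b′ * ms)))
    lhs = solve-∀
    rhs : ∀ b₁ b′ a′ z₁ Ns ms N w → N * a′ + b₁ + N * (Ns * z₁ + w * (b′ * ms))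
          ≡ N * Ns * z₁ + b₁ + (N * a′ + N * (w * (b′ * ms)))
    rhs = solve-∀

private
  -- A bad object carries weight `K`, the largest value that `z₁` can take. The hypotheses reduce to
  -- `L + K * z₂ ≤ z₁ ≤ K`, and since `1 ≤ L` not even one bad object can survive.
  extract : ∀ N K L z₁ z₂ {D E} → 1 ≤ N → 1 ≤ L → z₁ ≤ K →
            D + N * (K * z₂) ≤ N * z₁ + E → N * L + E ≤ D → L ≤ z₁ × z₂ ≡ 0
  extract N K L z₁ z₂ {D} {E} N≥1 L≥1 z₁≤K h size = ≤-trans (m≤m+n L _) sum≤ , zero? z₂ sum≤
    where
    regroup : ∀ N L E x → N * (L + x) + E ≡ N * L + E + N * x
    regroup = solve-∀
    sum≤ : L + K * z₂ ≤ z₁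
    sum≤ = *-cancelˡ-≤ N {{>-nonZero N≥1}} (+-cancelʳ-≤ E _ _
      (≤-trans (≤-reflexive (regroup N L E (K * z₂))) (≤-trans (+-monoˡ-≤ _ size) h)))
    zero? : ∀ z → L + K * z ≤ z₁ → z ≡ 0
    zero? zero    _ = refl
    zero? (suc z) g = contradiction (≤-trans (+-monoʳ-≤ 1 (m≤m*n K (suc z))) (≤-trans (+-monoˡ-≤ _ L≥1) (≤-trans g z₁≤K)))
                                    (n≮n K)

-- Pairs of vertex sets with many common neighbours on both sides.

module TwoSided {R : A → B → Set} (R? : ∀ x → Decidable (R x)) (n : ℕ) where
  nbrs : List A → List B → ℕ
  nbrs zs Y = # (λ y → all? (λ x → R? x y) zs) Y

  conbrs : List B → List A → ℕ
  conbrs zs X = # (λ x → all? (R? x) zs) X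

  -- Dependent random choice in which the unwanted objects are the `q`-tuples of `X` with at most
  -- `n` common neighbours in `Y`. Such a tuple survives only if all of `T` lies among those few
  -- neighbours. With weight `length X`, `extract` leaves at least `L` vertices of `X` and no
  -- unwanted tuple.
  commonNeighbourhood : ∀ {X : List A} {Y : List B} q s {d L} → 1 ≤ length Y → 1 ≤ L →
    (∀ {x} → x ∈ X → d ≤ # (R? x) Y) →
    length Y ^ s * L + length X * (length X ^ q * n ^ s) ≤ length X * d ^ s →
    ∃ λ T → L ≤ conbrs T X ×
      (∀ {zs} → All (λ x → x ∈ X × All (R x) T) zs → length zs ≡ q → n < nbrs zs Y)
  commonNeighbourhood {X} {Y} q s {d} {L} neY 1≤L deg size
    with dependentChoice R? (λ zs y → all? (λ x → R? x y) zs) (length X) {m = n} {ys = Y} neY s X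
             (filter (λ zs → nbrs zs Y ≤? n) (tuples q X)) deg
             (proj₂ ∘ ∈-filter⁻ (λ zs → nbrs zs Y ≤? n) {xs = tuples q X})
  ... | T , _ , _ , h = T , many , good
    where
    bad = filter (λ zs → nbrs zs Y ≤? n) (tuples q X)
    surviving = # (λ zs → all? (λ y → all? (λ x → R? x y) zs) T) bad
    K = length X
    N^s = length Y ^ s
    few : length bad ≤ K ^ q
    few = ≤-trans (length-filter _ (tuples q X)) (≤-reflexive (length-tuples q X))
    h′ : K * d ^ s + N^s * (K * surviving) ≤ N^s * conbrs T X + K * (K ^ q * n ^ s)
    h′ = ≤-trans h (+-monoʳ-≤ _ (*-monoʳ-≤ K (*-monoˡ-≤ (n ^ s) few)))
    conclusion = extract N^s K L _ surviving (m^n>0 (length Y) {{>-nonZero neY}} s) 1≤L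
                   (#≤length (λ x → all? (R? x) T) X) h′ size
    many = proj₁ conclusion
    none = proj₂ conclusion
    good : ∀ {zs} → All (λ x → x ∈ X × All (R x) T) zs → length zs ≡ q → n < nbrs zs Y
    good {zs} zs∈ refl with n <? nbrs zs Y
    ... | yes p = p
    ... | no ¬p = contradiction (All.tabulate λ y∈ → All.map (λ (_ , r) → All.lookup r y∈) zs∈)
      (#≡0⇒none (λ zs → all? (λ y → all? (λ x → R? x y) zs) T) none
        (∈-filter⁺ (λ zs → nbrs zs Y ≤? n) (∈-tuples (All.map proj₁ zs∈)) (≮⇒≥ ¬p)))

  -- A union bound over the poor t-tuples of Y, obtained from dependentChoice by letting as
  -- be a single point adjacent to everything.
  richAgainst : ∀ {U : List A} {Y : List B} t r → 1 ≤ length U → length Y ^ t * n ^ r < length U ^ r →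
    ∃ λ T → length T ≡ r × All (_∈ U) T ×
      (∀ {zs} → All (λ y → y ∈ Y × All (λ x → R x y) T) zs → length zs ≡ t → n < conbrs zs U)
  richAgainst {U} {Y} t r neU size
    with dependentChoice {R = λ _ _ → ⊤} (λ _ _ → yes tt) (λ zs x → all? (R? x) zs) 1 {d = length U} {m = n} {ys = U} neU r (tt ∷ [])
             (filter (λ zs → conbrs zs U ≤? n) (tuples t Y))
             (λ _ → ≤-reflexive (sym (trans (∑-const 1 U) (*-identityʳ _)))) (proj₂ ∘ ∈-filter⁻ (λ zs → conbrs zs U ≤? n) {xs = tuples t Y})
  ... | T , len , T∈ , h = T , len , T∈ , good
    where
    bad = filter (λ zs → conbrs zs U ≤? n) (tuples t Y)
    surviving = # (λ zs → all? (λ x → all? (R? x) zs) T) bad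
    few : length bad ≤ length Y ^ t
    few = ≤-trans (length-filter _ (tuples t Y)) (≤-reflexive (length-tuples t Y))
    none : surviving ≡ 0
    none = vanish (length U ^ r) surviving h (#≤length (λ _ → all? (λ _ → yes tt) T) (tt ∷ []))
             (≤-<-trans (*-monoˡ-≤ (n ^ r) few) size)
      where
      -- Because `z₁ ≤ 1`, the inequality amounts to `M * z ≤ E < M`.
      vanish : ∀ M z {z₁ E} → 1 * M + M * (1 * z) ≤ M * z₁ + 1 * E → z₁ ≤ 1 → E < M → z ≡ 0
      vanish M zero    h z₁≤1 E<M = refl
      vanish M (suc z) {z₁} {E} h z₁≤1 E<M = contradiction
        (≤-trans (+-monoʳ-≤ (1 * M) (m≤m*n M (1 * suc z))) (≤-trans h
          (+-mono-≤ (≤-trans (*-monoʳ-≤ M z₁≤1) (≤-reflexive (*-comm M 1))) (≤-reflexive (*-identityˡ E)))))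
        (<⇒≱ (+-monoʳ-< (1 * M) E<M))
    good : ∀ {zs} → All (λ y → y ∈ Y × All (λ x → R x y) T) zs → length zs ≡ t → n < conbrs zs U
    good {zs} zs∈ refl with n <? conbrs zs U
    ... | yes p = p
    ... | no ¬p = contradiction (All.tabulate λ x∈ → All.map (λ (_ , r) → All.lookup r x∈) zs∈)
      (#≡0⇒none (λ zs → all? (λ x → all? (R? x) zs) T) none
        (∈-filter⁺ (λ zs → conbrs zs U ≤? n) (∈-tuples (All.map proj₁ zs∈)) (≮⇒≥ ¬p)))

  -- What a greedy embedding of a `t`-degenerate bipartite graph on `n` vertices asks of its host:
  -- any `t` vertices of one side keep more than `n` common neighbours on the other, so one remains
  -- after discarding `n` used vertices. `U-point` provides a vertex for filling shorter lists up to
  -- length `t`.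
  record RichPair (t : ℕ) (X : List A) (Y : List B) : Set where
    field
      U        : List A
      W        : List B
      U⊆X      : ∀ {x} → x ∈ U → x ∈ X
      U-unique : Unique X → Unique U
      W-unique : Unique Y → Unique W
      U-point  : ∃ (_∈ U)
      U-rich   : ∀ {zs} → All (_∈ U) zs → length zs ≡ t → n < nbrs zs W
      W-rich   : ∀ {zs} → All (_∈ W) zs → length zs ≡ t → n < conbrs zs U

  -- The first round makes all `(t + r)`-tuples of `U` rich towards `Y`. The second picks an
  -- `r`-tuple `T₂` in `U` and sets `W` to be its common neighbourhood in `Y`. A `t`-tuple of `U`
  -- joined with `T₂` still has more than `n` common neighbours in `Y`, and these lie in `W`; so
  -- shrinking `Y` to `W` costs `U` nothing. Poor `t`-tuples are kept out of `W` by the choice of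
  -- `T₂`.
  richPair : ∀ {X : List A} {Y : List B} t r s {d L} → 1 ≤ length Y → 1 ≤ L →
    (∀ {x} → x ∈ X → d ≤ # (R? x) Y) →
    length Y ^ s * L + length X * (length X ^ (t + r) * n ^ s) ≤ length X * d ^ s →
    length Y ^ t * n ^ r < L ^ r → RichPair t X Y
  richPair {X} {Y} t r s {L = L} neY 1≤L deg size₁ size₂ with commonNeighbourhood {Y = Y} (t + r) s neY 1≤L deg size₁
  ... | T₁ , many , good₁ = record
    { U = U ; W = W
    ; U⊆X = proj₁ ∘ ∈-filter⁻ inU
    ; U-unique = Unique.filter⁺ inU
    ; W-unique = Unique.filter⁺ inW
    ; U-point = point U neU
    ; U-rich = λ {zs} zs∈ len → ≤-trans
        (good₁ {zs ++ T₂} (All.map (∈-filter⁻ inU) (All.++⁺ zs∈ T₂∈))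
          (trans (length-++ zs) (cong₂ _+_ len T₂-length)))
        (≤-trans (#-mono (λ y → all? (λ x → R? x y) (zs ++ T₂)) (λ y → inW y ×-dec all? (λ x → R? x y) zs) Y
            λ _ rs → All.++⁻ʳ zs rs , All.++⁻ˡ zs rs)
          (≤-reflexive (sym (#-filter-× inW (λ y → all? (λ x → R? x y) zs) Y))))
    ; W-rich = λ zs∈ len → good₂ (All.map (∈-filter⁻ inW) zs∈) len
    }
    where
    inU = λ x → all? (R? x) T₁
    U = filter inU X
    |U| : L ≤ length U
    |U| = ≤-trans many (≤-reflexive (#-filter inU X))
    neU = ≤-trans 1≤L |U|
    step = richAgainst {U} {Y} t r neU (<-≤-trans size₂ (^-monoˡ-≤ r |U|))
    T₂ = proj₁ step
    T₂-length = proj₁ (proj₂ step)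
    T₂∈ = proj₁ (proj₂ (proj₂ step))
    good₂ = proj₂ (proj₂ (proj₂ step))
    inW = λ y → all? (λ x → R? x y) T₂
    W = filter inW Y
    point : ∀ U → 1 ≤ length U → ∃ (_∈ U)
    point (x ∷ _) _ = x , here refl

-- Greedy embedding along a degeneracy order.

module GreedyEmbedding {n t : ℕ} (H : Graph n)
  (side : Fin n → Bool) (proper : ∀ i j → Edge H i j → side i ≢ side j)
  (pos : Fin n → Fin n) (pos-inj : Injective _≡_ _≡_ pos)
  (few : ∀ v → count (λ u → Adj H u v ∧ (pos u <ᵇ pos v)) ≤ t)
  {V : Set} (dom : Bool → List V) (rel : Bool → V → V → Set)
  (rel-sym : ∀ b {x y} → rel b x y → rel (not b) y x)
  (extend : ∀ b zs → All (_∈ dom (not b)) zs → length zs ≤ t → ∀ used → length used ≤ n →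
            ∃ λ x → x ∈ dom b × All (rel b x) zs × x ∉ used) where

  -- The map is total, but only its values on vertices at positions below `k` are constrained; the
  -- other values are placeholders.
  record Embeds (k : ℕ) (φ : Fin n → V) : Set where
    field
      inside    : ∀ {v} → toℕ (pos v) < k → φ v ∈ dom (side v)
      adjacent  : ∀ {u v} → toℕ (pos u) < k → toℕ (pos v) < k → Edge H u v → rel (side u) (φ u) (φ v)
      injective : ∀ {u v} → toℕ (pos u) < k → toℕ (pos v) < k → φ u ≡ φ v → u ≡ v
  open Embeds

  opposite : ∀ {u v} → Edge H u v → side u ≡ not (side v)
  opposite {u} {v} e = ¬-not (proper u v e)

  -- The earlier neighbours of `v` lie on the opposite side and number at most `t`, so `extend`
  -- supplies an image related to all of theirs. An edge between placed vertices either was present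
  -- before or has `v` as one end, in which case `rel-sym` turns the relation to the required side.
  place : ∀ {k φ} → Embeds k φ → ∀ v → toℕ (pos v) ≡ k → ∃ (Embeds (suc k))
  place {k} {φ} emb v refl = φ′ , record { inside = inside′ ; adjacent = adjacent′ ; injective = injective′ }
    where
    earlier = λ u → T? (Adj H u v ∧ (pos u <ᵇ pos v))
    earlier⁻ : ∀ {u} → T (Adj H u v ∧ (pos u <ᵇ pos v)) → Edge H u v × toℕ (pos u) < toℕ (pos v)
    earlier⁻ p = let e , l = Equivalence.to T-∧ p in Equivalence.to T-≡ e , <ᵇ⇒< _ _ l
    earlier⁺ : ∀ {u} → Edge H u v → toℕ (pos u) < toℕ (pos v) → T (Adj H u v ∧ (pos u <ᵇ pos v))
    earlier⁺ e l = Equivalence.from T-∧ (Equivalence.from T-≡ e , <⇒<ᵇ l)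
    zs = map φ (filter earlier (allFin n))
    zs∈ : All (_∈ dom (not (side v))) zs
    zs∈ = All.map⁺ (All.tabulate λ u∈ →
      let e , l = earlier⁻ (proj₂ (∈-filter⁻ earlier {xs = allFin n} u∈))
      in subst (λ b → _ ∈ dom b) (opposite e) (inside emb l))
    found = extend (side v) zs zs∈
      (≤-trans (≤-reflexive (trans (length-map φ (filter earlier (allFin n))) (sym (#-filter earlier (allFin n))))) (few v))
      -- The new image avoids every value of `φ`, placeholders included; the list of these has
      -- length `n`, within the allowance of `extend`.
      (map φ (allFin n)) (≤-reflexive (trans (length-map φ (allFin n)) (length-tabulate (λ (i : Fin n) → i))))
    x = proj₁ found
    x∈ = proj₁ (proj₂ found)
    x-rel : ∀ {u} → Edge H u v → toℕ (pos u) < toℕ (pos v) → rel (side v) x (φ u)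
    x-rel e l = All.lookup (proj₁ (proj₂ (proj₂ found)))
      (∈-map⁺ φ (∈-filter⁺ earlier (∈-allFin _) (earlier⁺ e l)))
    x-fresh : ∀ u → φ u ≢ x
    x-fresh u e = proj₂ (proj₂ (proj₂ found)) (subst (_∈ map φ (allFin n)) e (∈-map⁺ φ (∈-allFin u)))
    φ′ : Fin n → V
    φ′ u = if does (u Fin.≟ v) then x else φ u
    before : ∀ {u} → u ≢ v → toℕ (pos u) < suc k → toℕ (pos u) < k
    before u≢v l = ≤∧≢⇒< (≤-pred l) (u≢v ∘ pos-inj ∘ Fin.toℕ-injective)
    inside′ : ∀ {u} → toℕ (pos u) < suc k → φ′ u ∈ dom (side u)
    inside′ {u} l with u Fin.≟ v
    ... | yes refl = x∈
    ... | no u≢v   = inside emb (before u≢v l)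
    adjacent′ : ∀ {u w} → toℕ (pos u) < suc k → toℕ (pos w) < suc k → Edge H u w → rel (side u) (φ′ u) (φ′ w)
    adjacent′ {u} {w} l l′ e with u Fin.≟ v | w Fin.≟ v
    ... | yes refl | yes refl = ⊥-elim (proper u u e refl)
    ... | yes refl | no w≢v   = x-rel (trans (Graph.sym H w u) e) (before w≢v l′)
    ... | no u≢v   | yes refl = subst (λ b → rel b (φ u) x) (sym (opposite e))
                                  (rel-sym (side w) (x-rel e (before u≢v l)))
    ... | no u≢v   | no w≢v   = adjacent emb (before u≢v l) (before w≢v l′) e
    injective′ : ∀ {u w} → toℕ (pos u) < suc k → toℕ (pos w) < suc k → φ′ u ≡ φ′ w → u ≡ w
    injective′ {u} {w} l l′ e with u Fin.≟ v | w Fin.≟ v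
    ... | yes refl | yes refl = refl
    ... | yes refl | no _     = contradiction (sym e) (x-fresh w)
    ... | no _     | yes refl = contradiction e (x-fresh u)
    ... | no u≢v   | no w≢v   = injective emb (before u≢v l) (before w≢v l′) e

  embed : ∀ k → ∃ (Embeds k)
  -- Any host vertex serves as the initial placeholder; `extend` with empty lists provides one.
  embed zero = (λ _ → proj₁ (extend true [] [] z≤n [] z≤n)) ,
               record { inside = λ () ; adjacent = λ () ; injective = λ () }
  embed (suc k) with embed k | Fin.any? (λ v → toℕ (pos v) ≟ k)
  ... | φ , emb | yes (v , e) = place emb v e
  -- No vertex sits at position `k`, so nothing has to be placed. This case spares a proof that
  -- `pos` is surjective.
  ... | φ , emb | no none = φ , record
    { inside    = inside emb ∘ before
    ; adjacent  = λ l l′ → adjacent emb (before l) (before l′)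
    ; injective = λ l l′ → injective emb (before l) (before l′)
    }
    where
    before : ∀ {u} → toℕ (pos u) < suc k → toℕ (pos u) < k
    before l = ≤∧≢⇒< (≤-pred l) (λ e → none (_ , e))

  embedding : ∃ λ (φ : Fin n → V) → (∀ v → φ v ∈ dom (side v)) ×
    (∀ {u v} → Edge H u v → rel (side u) (φ u) (φ v)) × (∀ {u v} → φ u ≡ φ v → u ≡ v)
  embedding = let φ , emb = embed n in
    φ , (λ v → inside emb (Fin.toℕ<n _)) , adjacent emb (Fin.toℕ<n _) (Fin.toℕ<n _) , injective emb (Fin.toℕ<n _) (Fin.toℕ<n _)

-- Selecting by colour, and orderings from keys.

-- The value class of the first entry either has `K` members or can be removed at a cost of fewer
-- than `K` entries. In the latter case the first entry is kept as a representative, and the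
-- remainder suffices for `j - 1` further classes.
constantOrInjective : (f : A → ℕ) (K j : ℕ) {xs : List A} → Unique xs → j * K ≤ length xs →
  (∃₂ λ κ ys → length ys ≡ K × Unique ys × All (λ y → y ∈ xs × f y ≡ κ) ys) ⊎
  (∃ λ ys → length ys ≡ j × All (_∈ xs) ys × AllPairs (λ y z → f y ≢ f z) ys)
constantOrInjective f zero zero    u h = inj₂ ([] , refl , [] , [])
constantOrInjective f zero (suc j) u h = inj₁ (0 , [] , refl , [] , [])
constantOrInjective f (suc K) zero u h = inj₂ ([] , refl , [] , [])
constantOrInjective f (suc K) (suc j) {x ∷ xs} u h with suc K ≤? # (λ y → f y ≟ f x) (x ∷ xs)
... | yes many = inj₁ (f x , take (suc K) class
    , trans (length-take (suc K) class) (m≤n⇒m⊓n≡m (≤-trans many (≤-reflexive (#-filter (λ y → f y ≟ f x) (x ∷ xs)))))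
    , Unique.take⁺ (suc K) (Unique.filter⁺ (λ y → f y ≟ f x) u)
    , All.take⁺ (suc K) (All.tabulate (∈-filter⁻ (λ y → f y ≟ f x))))
  where class = filter (λ y → f y ≟ f x) (x ∷ xs)
... | no ¬many with constantOrInjective f (suc K) j {rest} (Unique.filter⁺ (λ y → ¬? (f y ≟ f x)) u) enough
  where
  rest = filter (λ y → ¬? (f y ≟ f x)) (x ∷ xs)
  enough : j * suc K ≤ length rest
  enough = +-cancelˡ-≤ (suc K) _ _ (≤-trans h (≤-trans
    (≤-reflexive (sym (#-complement (λ y → f y ≟ f x) (x ∷ xs))))
    (+-mono-≤ (<⇒≤ (≰⇒> ¬many)) (≤-reflexive (#-filter (λ y → ¬? (f y ≟ f x)) (x ∷ xs))))))
... | inj₁ (κ , ys , len , uniq , all) =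
  inj₁ (κ , ys , len , uniq , All.map (λ (y∈ , e) → proj₁ (∈-filter⁻ (λ y → ¬? (f y ≟ f x)) y∈) , e) all)
... | inj₂ (ys , len , ys∈ , distinct) =
  inj₂ (x ∷ ys , cong suc len
    , here refl ∷ All.map (proj₁ ∘ ∈-filter⁻ (λ y → ¬? (f y ≟ f x))) ys∈
    , All.map (λ y∈ e → proj₂ (∈-filter⁻ (λ y → ¬? (f y ≟ f x)) {xs = x ∷ xs} y∈) (sym e)) ys∈ ∷ distinct)

AllPairs-injective : {f : A → ℕ} {xs : List A} → AllPairs (λ y z → f y ≢ f z) xs →
  ∀ {x y} → x ∈ xs → y ∈ xs → f x ≡ f y → x ≡ y
AllPairs-injective (_ ∷ _)  (here refl) (here refl) e = refl
AllPairs-injective (h ∷ _)  (here refl) (there y∈)  e = contradiction e (All.lookup h y∈)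
AllPairs-injective (h ∷ _)  (there x∈)  (here refl) e = contradiction (sym e) (All.lookup h x∈)
AllPairs-injective (_ ∷ hs) (there x∈)  (there y∈)  e = AllPairs-injective hs x∈ y∈ e

-- The position of `v` is the number of vertices with a smaller key. A vertex does not count itself,
-- which makes this number less than `n` and strictly increasing in the key.
rank : ∀ {n} (key : Fin n → ℕ) → Injective _≡_ _≡_ key →
  Σ (Ordering n) λ (pos , _) → ∀ {u v} → key u < key v → toℕ (pos u) < toℕ (pos v)
rank {n} key key-inj = (pos , pos-inj) , pos-mono
  where
  below : ∀ v → ℕ
  below v = # (λ u → key u <? key v) (allFin n)
  #-strict : ∀ {xs u v} → key u < key v → u ∈ xs → # (λ w → key w <? key u) xs < # (λ w → key w <? key v) xs
  #-strict {x ∷ xs} {u} {v} l (here refl) =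
    +-mono-<-≤ (strict (key x <? key x) (key x <? key v) (n≮n _) l)
      (#-mono (λ w → key w <? key u) (λ w → key w <? key v) xs λ _ l′ → <-trans l′ l)
    where
    strict : ∀ {X Y : Set} (d : Dec X) (e : Dec Y) → ¬ X → Y → indicator d < indicator e
    strict (yes x) _       ¬x y = contradiction x ¬x
    strict (no _)  (yes _) ¬x y = s≤s z≤n
    strict (no _)  (no ¬y) ¬x y = contradiction y ¬y
  #-strict {x ∷ xs} {u} {v} l (there u∈) =
    +-mono-≤-< (indicator-mono (key x <? key u) (key x <? key v) λ l′ → <-trans l′ l) (#-strict l u∈)
  below<n : ∀ v → below v < n
  below<n v = <-≤-trans
    (+-monoˡ-< (below v) (≤-trans (s≤s z≤n) (someone (allFin n) (∈-allFin v))))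
    (≤-trans (≤-reflexive (+-comm _ (below v))) (≤-reflexive (trans (#-complement (λ u → key u <? key v) (allFin n)) (length-tabulate _))))
    where
    someone : ∀ xs → v ∈ xs → 1 ≤ # (λ u → ¬? (key u <? key v)) xs
    someone xs v∈ with # (λ u → ¬? (key u <? key v)) xs in e
    ... | zero  = contradiction (n≮n _) (#≡0⇒none (λ u → ¬? (key u <? key v)) e v∈)
    ... | suc _ = s≤s z≤n
  pos : Fin n → Fin n
  pos v = fromℕ< (below<n v)
  pos-mono : ∀ {u v} → key u < key v → toℕ (pos u) < toℕ (pos v)
  pos-mono l = subst₂ _<_ (sym (Fin.toℕ-fromℕ< _)) (sym (Fin.toℕ-fromℕ< _)) (#-strict l (∈-allFin _))
  pos-inj : Injective _≡_ _≡_ pos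
  pos-inj {u} {v} e with <-cmp (key u) (key v)
  ... | tri< l _ _ = contradiction (cong toℕ e) (<⇒≢ (pos-mono l))
  ... | tri≈ _ k _ = key-inj k
  ... | tri> _ _ l = contradiction (cong toℕ (sym e)) (<⇒≢ (pos-mono l))

-- A rainbow clique among light vertices.

module RainbowClique {V : Set} (_≟ᵥ_ : DecidableEquality V) (c : V → V → ℕ) (c-sym : ∀ x y → c x y ≡ c y x)
  {L : List V} (unique : Unique L) {d : ℕ}
  (light : ∀ {y} κ → y ∈ L → # (λ u → κ ≟ c y u) L ≤ d) where

  IsRainbow : ∀ {k} → (Fin k → V) → Set
  IsRainbow φ = ∀ {i j k l} → i ≢ j → k ≢ l → c (φ i) (φ j) ≡ c (φ k) (φ l) →
                (i ≡ k × j ≡ l) ⊎ (i ≡ l × j ≡ k)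

  cherries : V → V → ℕ
  cherries u v = # (λ y → c y u ≟ c y v) L

  cherries-sym : ∀ u v → cherries u v ≤ cherries v u
  cherries-sym u v = #-mono (λ y → c y u ≟ c y v) (λ y → c y v ≟ c y u) L λ _ → sym

  -- Counted by centre: once `u` and the centre `y` are fixed, lightness of `y` allows at most `d`
  -- choices of `v`.
  ∑-cherries : ∑ (λ u → ∑ (cherries u) L) L ≤ length L * (length L * d)
  ∑-cherries = ∑-≤-const L λ {u} _ →
    ≤-trans (≤-reflexive (∑-swap (λ v y → indicator (c y u ≟ c y v)) L L))
            (∑-≤-const L λ {y} y∈ → light (c y u) y∈)

  module _ (D : ℕ) where

    popularity : V → ℕ
    popularity u = # (λ v → D ≤? cherries u v) L

    popular : ℕ
    popular = # (λ u → D ≤? popularity u) L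

    -- Markov's inequality twice: a popular `u` has at least `D` partners, with at least `D`
    -- cherries each, and so contributes `D * D` to the total.
    popular-bound : popular * D * D ≤ length L * (length L * d)
    popular-bound = begin
      popular * D * D                  ≤⟨ *-monoˡ-≤ D (markov popularity D L) ⟩
      ∑ popularity L * D               ≡⟨ ∑-*ʳ D popularity L ⟨
      ∑ (λ u → popularity u * D) L     ≤⟨ ∑-mono L (λ {u} _ → markov (cherries u) D L) ⟩
      ∑ (λ u → ∑ (cherries u) L) L     ≤⟨ ∑-cherries ⟩
      length L * (length L * d)        ∎
      where open ≤-Reasoning

    -- `unpopular` and `sparse` keep room for later vertices: a member rules out at most `D`
    -- vertices as partners, and a pair of members rules out at most `D` vertices as centres of a
    -- cherry on it.
    record Good {k} (φ : Fin k → V) : Set where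
      field
        inside    : ∀ i → φ i ∈ L
        unpopular : ∀ i → popularity (φ i) ≤ D
        sparse    : ∀ {i j} → i ≢ j → cherries (φ i) (φ j) ≤ D
        injective : ∀ {i j} → φ i ≡ φ j → i ≡ j
        rainbow   : IsRainbow φ

    -- A union bound over the obstacles to a new vertex `y`. It may be popular, already used, in too
    -- many cherries with a member (`k * D`), centre of a cherry on two members (`k * (k * D)`), or
    -- joined to a member in the colour of a pair of members (`k * (k * (k * d))`). Any other vertex
    -- of `L` keeps all the invariants.
    append : ∀ {k} {φ : Fin k → V} → Good φ →
             popular + (k * 1 + (k * D + (k * (k * D) + k * (k * (k * d))))) < length L →
             ∃ λ (φ′ : Fin (suc k) → V) → Good φ′
    append {k} {φ} good room
      with #-avoid (λ _ → yes tt)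
             (λ y → D ≤? popularity y ⊎-dec (used y ⊎-dec (partner y ⊎-dec (cherry y ⊎-dec conflict y)))) {L}
             (≤-<-trans excluded (<-≤-trans room (≤-reflexive (sym (trans (∑-const 1 L) (*-identityʳ _))))))
      where
      open Good good
      ks = allFin k
      |ks| = length-tabulate (λ (i : Fin k) → i)
      used = λ y → any? (λ i → φ i ≟ᵥ y) ks
      partner = λ y → any? (λ i → D ≤? cherries (φ i) y) ks
      cherry = λ y → any? (λ i → any? (λ j → ¬? (i Fin.≟ j) ×-dec (c y (φ i) ≟ c y (φ j))) ks) ks
      conflict = λ y → any? (λ i → any? (λ p → any? (λ q → c (φ p) (φ q) ≟ c (φ i) y) ks) ks) ks
      any-bound : ∀ {R : Fin k → V → Set} (R? : ∀ i → Decidable (R i)) {b} → (∀ i → # (R? i) L ≤ b) →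
                  # (λ y → any? (λ i → R? i y) ks) L ≤ k * b
      any-bound R? {b} h = ≤-trans (#-any R? ks L (λ {i} _ → h i)) (≤-reflexive (cong (_* b) |ks|))
      cherry-bound : ∀ i j → # (λ y → ¬? (i Fin.≟ j) ×-dec (c y (φ i) ≟ c y (φ j))) L ≤ D
      cherry-bound i j with i Fin.≟ j
      ... | yes _  = ≤-trans (≤-reflexive (trans (∑-const 0 L) (*-zeroʳ (length L)))) z≤n
      ... | no i≢j = sparse i≢j
      excluded : # (λ y → D ≤? popularity y ⊎-dec (used y ⊎-dec (partner y ⊎-dec (cherry y ⊎-dec conflict y)))) L
                 ≤ popular + (k * 1 + (k * D + (k * (k * D) + k * (k * (k * d)))))
      excluded =
        ≤-trans (#-⊎ (λ y → D ≤? popularity y) (λ y → used y ⊎-dec (partner y ⊎-dec (cherry y ⊎-dec conflict y))) L) (+-monoʳ-≤ popular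
        (≤-trans (#-⊎ used (λ y → partner y ⊎-dec (cherry y ⊎-dec conflict y)) L) (+-mono-≤
          (any-bound (λ i y → φ i ≟ᵥ y) (λ i → #-≡ _≟ᵥ_ (φ i) unique))
        (≤-trans (#-⊎ partner (λ y → cherry y ⊎-dec conflict y) L) (+-mono-≤
          (any-bound (λ i y → D ≤? cherries (φ i) y) unpopular)
        (≤-trans (#-⊎ cherry conflict L) (+-mono-≤
          (any-bound (λ i y → any? (λ j → ¬? (i Fin.≟ j) ×-dec (c y (φ i) ≟ c y (φ j))) ks) λ i →
            any-bound (λ j y → ¬? (i Fin.≟ j) ×-dec (c y (φ i) ≟ c y (φ j))) (cherry-bound i))
          (any-bound (λ i y → any? (λ p → any? (λ q → c (φ p) (φ q) ≟ c (φ i) y) ks) ks) λ i →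
            any-bound (λ p y → any? (λ q → c (φ p) (φ q) ≟ c (φ i) y) ks) λ p →
            any-bound (λ q y → c (φ p) (φ q) ≟ c (φ i) y) λ q → light (c (φ p) (φ q)) (inside i)))))))))
    ... | y , y∈ , _ , fine = φ′ , record
      { inside    = λ { zero → y∈ ; (suc i) → inside i }
      ; unpopular = λ { zero → <⇒≤ (≰⇒> (fine ∘ inj₁)) ; (suc i) → unpopular i }
      ; sparse    = sparse′
      ; injective = injective′
      ; rainbow   = rainbow′
      }
      where
      open Good good
      φ′ : Fin (suc k) → V
      φ′ zero    = y
      φ′ (suc i) = φ i
      some : ∀ {R : Fin k → Set} i → R i → Any R (allFin k)
      some i r = lose (∈-allFin i) r
      fresh : ∀ i → φ i ≢ y
      fresh i e = fine (inj₂ (inj₁ (some i e)))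
      nonpartner : ∀ i → cherries (φ i) y ≤ D
      nonpartner i = <⇒≤ (≰⇒> λ l → fine (inj₂ (inj₂ (inj₁ (some i l)))))
      sparse′ : ∀ {i j} → i ≢ j → cherries (φ′ i) (φ′ j) ≤ D
      sparse′ {zero}  {zero}  i≢j = contradiction refl i≢j
      sparse′ {zero}  {suc j} i≢j = ≤-trans (cherries-sym y (φ j)) (nonpartner j)
      sparse′ {suc i} {zero}  i≢j = nonpartner i
      sparse′ {suc i} {suc j} i≢j = sparse (i≢j ∘ cong suc)
      injective′ : ∀ {i j} → φ′ i ≡ φ′ j → i ≡ j
      injective′ {zero}  {zero}  e = refl
      injective′ {zero}  {suc j} e = contradiction (sym e) (fresh j)
      injective′ {suc i} {zero}  e = contradiction e (fresh i)
      injective′ {suc i} {suc j} e = cong suc (injective e)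
      star : ∀ i j → c y (φ i) ≡ c y (φ j) → suc i ≡ suc j
      star i j e with i Fin.≟ j
      ... | yes i≡j = cong suc i≡j
      ... | no i≢j  = contradiction (inj₂ (inj₂ (inj₂ (inj₁ (some i (some j (i≢j , e))))))) fine
      new : ∀ {B : Set} i p q → c y (φ i) ≡ c (φ p) (φ q) → B
      new i p q e = contradiction (inj₂ (inj₂ (inj₂ (inj₂ (some i (some p (some q (trans (sym e) (c-sym y (φ i)))))))))) fine
      -- Two edges at the new vertex are separated by `star`, a new edge and an old one by `new`,
      -- two old edges by the invariant.
      rainbow′ : IsRainbow φ′
      rainbow′ {zero}  {zero}                  i≢j k≢l e = contradiction refl i≢j
      rainbow′ {_}     {_}     {zero}  {zero}  i≢j k≢l e = contradiction refl k≢l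
      rainbow′ {zero}  {suc j} {zero}  {suc l} i≢j k≢l e = inj₁ (refl , star j l e)
      rainbow′ {zero}  {suc j} {suc k} {zero}  i≢j k≢l e = inj₂ (refl , star j k (trans e (c-sym _ _)))
      rainbow′ {zero}  {suc j} {suc k} {suc l} i≢j k≢l e = new j k l e
      rainbow′ {suc i} {zero}  {zero}  {suc l} i≢j k≢l e = inj₂ (star i l (trans (c-sym _ _) e) , refl)
      rainbow′ {suc i} {zero}  {suc k} {zero}  i≢j k≢l e = inj₁ (star i k (trans (c-sym _ _) (trans e (c-sym _ _))) , refl)
      rainbow′ {suc i} {zero}  {suc k} {suc l} i≢j k≢l e = new i k l (trans (c-sym _ _) e)
      rainbow′ {suc i} {suc j} {zero}  {suc l} i≢j k≢l e = new l i j (sym e)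
      rainbow′ {suc i} {suc j} {suc k} {zero}  i≢j k≢l e = new k i j (trans (c-sym _ _) (sym e))
      rainbow′ {suc i} {suc j} {suc k} {suc l} i≢j k≢l e =
        Sum.map (Product.map (cong suc) (cong suc)) (Product.map (cong suc) (cong suc))
                (rainbow (i≢j ∘ cong suc) (k≢l ∘ cong suc) e)

    clique : ∀ n → popular + (n * 1 + (n * D + (n * (n * D) + n * (n * (n * d))))) < length L →
             ∀ k → k ≤ n → ∃ λ (φ : Fin k → V) → Good φ
    clique n room zero    k≤n = (λ ()) , record
      { inside = λ () ; unpopular = λ () ; sparse = λ { {()} } ; injective = λ { {()} } ; rainbow = λ { {()} } }
    clique n room (suc k) k<n with clique n room k (<⇒≤ k<n)
    ... | φ , good = append good (≤-<-trans (+-monoʳ-≤ popular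
        (+-mono-≤ (*-monoˡ-≤ 1 k≤n) (+-mono-≤ (*-monoˡ-≤ D k≤n)
          (+-mono-≤ (*-mono-≤ k≤n (*-monoˡ-≤ D k≤n)) (*-mono-≤ k≤n (*-mono-≤ k≤n (*-monoˡ-≤ d k≤n))))))) room)
      where k≤n = <⇒≤ k<n

  rainbowClique : ∀ n → 2 ≤ n → 1 ≤ d → length L ≤ n ^ 16 * d → n ^ 16 * d ≤ 2 * length L →
    ∃ λ (φ : Fin n → V) → (∀ {i j} → φ i ≡ φ j → i ≡ j) × IsRainbow φ
  rainbowClique n n≥2 d≥1 upper lower =
    let φ , good = clique D n room n ≤-refl in φ , Good.injective good , Good.rainbow good
    where
    -- This threshold brings both `n ^ 32 * d ^ 3 / D ^ 2`, which bounds the number of popular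
    -- vertices, and `n * (n * D)` to exactly `M`.
    D = n ^ 10 * d
    M = n ^ 12 * d
    ℓ = length L
    n≥1 = <⇒≤ n≥2
    instance _ = >-nonZero n≥1
    instance _ = >-nonZero d≥1
    D≥1 : 1 ≤ D
    D≥1 = *-mono-≤ (m^n>0 n 10) d≥1
    M≥1 : 1 ≤ M
    M≥1 = *-mono-≤ (m^n>0 n 12) d≥1
    popular≤M : popular D ≤ M
    popular≤M = *-cancelʳ-≤ _ _ (D * D) {{>-nonZero (*-mono-≤ D≥1 D≥1)}} (begin
      popular D * (D * D)                   ≡⟨ *-assoc (popular D) D D ⟨
      popular D * D * D                     ≤⟨ popular-bound D ⟩
      ℓ * (ℓ * d)                           ≤⟨ *-mono-≤ upper (*-monoˡ-≤ d upper) ⟩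
      n ^ 16 * d * (n ^ 16 * d * d)         ≡⟨ rearrange (n ^ 16) (n ^ 16) d ⟩
      n ^ 16 * n ^ 16 * (d * d * d)         ≡⟨ cong (_* (d * d * d)) powers ⟩
      n ^ 12 * (n ^ 10 * n ^ 10) * (d * d * d) ≡⟨ rearrange′ (n ^ 12) (n ^ 10) d ⟨
      M * (D * D)                           ∎)
      where
      open ≤-Reasoning
      rearrange : ∀ x y d → x * d * (y * d * d) ≡ x * y * (d * d * d)
      rearrange = solve-∀
      rearrange′ : ∀ x y d → x * d * (y * d * (y * d)) ≡ x * (y * y) * (d * d * d)
      rearrange′ = solve-∀
      powers : n ^ 16 * n ^ 16 ≡ n ^ 12 * (n ^ 10 * n ^ 10)
      powers = trans (sym (^-distribˡ-+-* n 16 16)) (trans (^-distribˡ-+-* n 12 20) (cong (n ^ 12 *_) (^-distribˡ-+-* n 10 10)))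
    n^≤M : ∀ k → k ≤ 12 → n ^ k * d ≤ M
    n^≤M k k≤12 = *-monoˡ-≤ d (^-monoʳ-≤ n k≤12)
    bound₁ : n * 1 ≤ M
    bound₁ = ≤-trans (≤-reflexive (sym (*-identityʳ (n ^ 1)))) (≤-trans (*-monoʳ-≤ (n ^ 1) d≥1) (n^≤M 1 (s≤s z≤n)))
    bound₂ : n * D ≤ M
    bound₂ = ≤-trans (≤-reflexive (sym (*-assoc n (n ^ 10) d))) (n^≤M 11 (m≤m+n 11 1))
    bound₃ : n * (n * D) ≤ M
    bound₃ = ≤-trans (*-monoʳ-≤ n (≤-reflexive (sym (*-assoc n (n ^ 10) d)))) (≤-reflexive (sym (*-assoc n (n ^ 11) d)))
    bound₄ : n * (n * (n * d)) ≤ M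
    bound₄ = ≤-trans (≤-reflexive (cube n d)) (n^≤M 3 (m≤m+n 3 9))
      where
      cube : ∀ n d → n * (n * (n * d)) ≡ n * (n * (n * 1)) * d
      cube = solve-∀
    -- Since `2 ^ 4 ≤ n ^ 4`, `16 * M` is at most `n ^ 16 * d`, hence at most `2 * ℓ`. The five
    -- kinds of obstacle take up only `5 * M`.
    8M≤ℓ : 8 * M ≤ ℓ
    8M≤ℓ = *-cancelˡ-≤ 2 (begin
      2 * (8 * M)          ≡⟨ *-assoc 2 8 M ⟨
      2 ^ 4 * M            ≤⟨ *-monoˡ-≤ M (^-monoˡ-≤ 4 n≥2) ⟩
      n ^ 4 * (n ^ 12 * d) ≡⟨ *-assoc (n ^ 4) (n ^ 12) d ⟨
      n ^ 4 * n ^ 12 * d   ≡⟨ cong (_* d) (^-distribˡ-+-* n 4 12) ⟨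
      n ^ 16 * d           ≤⟨ lower ⟩
      2 * ℓ                ∎)
      where open ≤-Reasoning
    room : popular D + (n * 1 + (n * D + (n * (n * D) + n * (n * (n * d))))) < ℓ
    room = begin-strict
      popular D + (n * 1 + (n * D + (n * (n * D) + n * (n * (n * d)))))
        ≤⟨ +-mono-≤ popular≤M (+-mono-≤ bound₁ (+-mono-≤ bound₂ (+-mono-≤ bound₃ bound₄))) ⟩
      M + (M + (M + (M + M)))  ≡⟨ five M ⟩
      5 * M                    <⟨ *-monoˡ-< M {{>-nonZero M≥1}} (m≤m+n 6 2) ⟩
      8 * M                    ≤⟨ 8M≤ℓ ⟩
      ℓ                        ∎
      where
      open ≤-Reasoning
      five : ∀ M → M + (M + (M + (M + M))) ≡ 5 * M
      five = solve-∀

-- Canonical copies of `H` from a rich pair.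

-- Degeneracy gives at most `t` earlier neighbours while richness speaks of exactly `t` vertices.
-- Copies of one vertex fill the gap, as `tuples` admits repetitions.
pad : ∀ {A : Set} {P : A → Set} {t x zs} → P x → All P zs → length zs ≤ t →
  ∃ λ ys → All P ys × length (zs ++ ys) ≡ t
pad {t = t} {x} {zs} px pzs l = replicate (t ∸ length zs) x , All.replicate⁺ _ px ,
  trans (length-++ zs) (trans (cong (length zs +_) (length-replicate (t ∸ length zs))) (m+[n∸m]≡n l))

≤∑ : ∀ {A : Set} (f : A → ℕ) {x xs} → x ∈ xs → f x ≤ ∑ f xs
≤∑ f (here refl)        = m≤m+n _ _
≤∑ f (there {y} {xs} x∈) = ≤-trans (≤∑ f x∈) (m≤n+m _ (f y))

-- The side marked `true` goes to `U`, the other to `W`. The two sets may overlap, so injectivity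
-- comes from avoiding used vertices: there are more than `n` common neighbours and at most `n` used
-- ones.
embedRichPair : ∀ {n t} (H : Graph n) ((side , _) : Bipartite H) → Degenerate t H →
  ∀ {V : Set} (_≟ᵥ_ : DecidableEquality V) {R : V → V → Set} (R? : ∀ x → Decidable (R x)) {X Y} →
  Unique X → Unique Y → TwoSided.RichPair R? n t X Y →
  ∃ λ (φ : Fin n → V) → Injective _≡_ _≡_ φ × (∀ v → side v ≡ true → φ v ∈ X) ×
    (∀ {u v} → Edge H u v → side u ≡ true → R (φ u) (φ v))
embedRichPair {n} {t} H (side , proper) ((pos , pos-inj) , few) {V} _≟ᵥ_ {R} R? uX uY rich =
  let φ , inside , adjacent , injective = embedding
  in φ , injective
       , (λ v e → U⊆X (subst (λ b → φ v ∈ dom b) e (inside v)))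
       , (λ {u} {v} E e → subst (λ b → rel b (φ u) (φ v)) e (adjacent E))
  where
  open TwoSided R? n
  open RichPair rich
  dom : Bool → List V
  dom true  = U
  dom false = W
  rel : Bool → V → V → Set
  rel true  x y = R x y
  rel false x y = R y x
  rel-sym : ∀ b {x y} → rel b x y → rel (not b) y x
  rel-sym true  r = r
  rel-sym false r = r
  W-point : ∃ (_∈ W)
  -- Richness of the tuple made of `t` copies of the point of `U` shows that `W` is not empty.
  W-point = let y , y∈ , _ = #-witness (λ y → all? (λ x → R? x y) (replicate t (proj₁ U-point)))
                               (≤-trans (s≤s z≤n) (U-rich (All.replicate⁺ t (proj₂ U-point)) (length-replicate t)))
            in y , y∈
  extend : ∀ b zs → All (_∈ dom (not b)) zs → length zs ≤ t → ∀ used → length used ≤ n →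
           ∃ λ x → x ∈ dom b × All (rel b x) zs × x ∉ used
  extend true zs zs∈ l used l′ =
    let ys , ys∈ , len = pad (proj₂ W-point) zs∈ l
        x , x∈ , rs , fresh = #-avoid (λ x → all? (R? x) (zs ++ ys)) (λ x → any? (_≟ᵥ x) used) {U}
          (≤-<-trans (≤-trans (#-∈ _≟ᵥ_ used (U-unique uX)) l′) (W-rich (All.++⁺ zs∈ ys∈) len))
    in x , x∈ , All.++⁻ˡ zs rs , fresh ∘ Any.map sym
  extend false zs zs∈ l used l′ =
    let ys , ys∈ , len = pad (proj₂ U-point) zs∈ l
        x , x∈ , rs , fresh = #-avoid (λ y → all? (λ x → R? x y) (zs ++ ys)) (λ x → any? (_≟ᵥ x) used) {W}
          (≤-<-trans (≤-trans (#-∈ _≟ᵥ_ used (W-unique uY)) l′) (U-rich (All.++⁺ zs∈ ys∈) len))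
    in x , x∈ , All.++⁻ˡ zs rs , fresh ∘ Any.map sym
  open GreedyEmbedding H side proper pos pos-inj few dom rel rel-sym extend

module _ {n N : ℕ} (H : Graph n) (side : Fin n → Bool) (proper : ∀ i j → Edge H i j → side i ≢ side j)
  (c : Fin N → Fin N → ℕ) (c-sym : ∀ x y → c x y ≡ c y x)
  (col : Fin N → ℕ) {φ : Fin n → Fin N} (φ-inj : Injective _≡_ _≡_ φ)
  (adjacent : ∀ {u v} → Edge H u v → side u ≡ true → c (φ u) (φ v) ≡ col (φ u)) where

  monochromatic : ∀ {κ} → (∀ v → side v ≡ true → col (φ v) ≡ κ) → Monochromatic H c φ
  monochromatic {κ} const = κ , colour
    where
    colour : ∀ i j → Edge H i j → c (φ i) (φ j) ≡ κ
    colour i j e with side i in eᵢ | side j in eⱼ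
    ... | true  | _     = trans (adjacent e eᵢ) (const i eᵢ)
    ... | false | true  = trans (c-sym _ _) (trans (adjacent (trans (Graph.sym H j i) e) eⱼ) (const j eⱼ))
    ... | false | false = contradiction (trans eᵢ (sym eⱼ)) (proper i j e)

  -- `key` lists the `true` side first, so the earlier end of every edge is a `true` vertex and
  -- determines the colour. The definition asks for distinct colours at all vertices; those on the
  -- `false` side have no later neighbours and receive fresh values from `big` upwards.
  lexicographic : (∀ u v → side u ≡ true → side v ≡ true → col (φ u) ≡ col (φ v) → φ u ≡ φ v) →
                  Lexicographic H c φ
  lexicographic col-inj = proj₁ ordering , colour , (λ {u} {v} → colour-inj u v) , correct
    where
    key : Fin n → ℕ
    key v with side v
    ... | true  = toℕ v
    ... | false = n + toℕ v
    key-inj : Injective _≡_ _≡_ key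
    key-inj {u} {v} e with side u | side v
    ... | true  | true  = Fin.toℕ-injective e
    ... | true  | false = contradiction e (<⇒≢ (<-≤-trans (Fin.toℕ<n u) (m≤m+n n _)))
    ... | false | true  = contradiction (sym e) (<⇒≢ (<-≤-trans (Fin.toℕ<n v) (m≤m+n n _)))
    ... | false | false = Fin.toℕ-injective (+-cancelˡ-≡ n _ _ e)
    key-< : ∀ {u v} → side u ≡ true → side v ≡ false → key u < key v
    key-< {u} {v} eᵤ eᵥ with side u | side v
    key-< {u} {v} refl refl | true | false = <-≤-trans (Fin.toℕ<n u) (m≤m+n n _)
    ordering = rank key key-inj
    big = suc (∑ (col ∘ φ) (allFin n))
    colour : Fin n → ℕ
    colour v = if side v then col (φ v) else big + toℕ v
    small : ∀ v → col (φ v) < big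
    small v = s≤s (≤∑ (col ∘ φ) (∈-allFin v))
    colour-inj : ∀ u v → colour u ≡ colour v → u ≡ v
    colour-inj u v e with side u in eᵤ | side v in eᵥ
    ... | true  | true  = φ-inj (col-inj u v eᵤ eᵥ e)
    ... | true  | false = contradiction e (<⇒≢ (<-≤-trans (small u) (m≤m+n big _)))
    ... | false | true  = contradiction (sym e) (<⇒≢ (<-≤-trans (small v) (m≤m+n big _)))
    ... | false | false = Fin.toℕ-injective (+-cancelˡ-≡ big _ _ e)
    correct : ∀ i j → Edge H i j → toℕ (proj₁ (proj₁ ordering) i) < toℕ (proj₁ (proj₁ ordering) j) →
              c (φ i) (φ j) ≡ colour i
    correct i j e l = by-side (side i) (side j) refl refl
      where
      by-side : ∀ b b′ → side i ≡ b → side j ≡ b′ → c (φ i) (φ j) ≡ colour i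
      by-side true  _     eᵢ _  = trans (adjacent e eᵢ) (sym (cong (if_then col (φ i) else big + toℕ i) eᵢ))
      by-side false true  eᵢ eⱼ = contradiction l (<-asym (proj₂ ordering (key-< eⱼ eᵢ)))
      by-side false false eᵢ eⱼ = contradiction (trans eᵢ (sym eⱼ)) (proper i j e)

-- Heavy and light vertices.

module Dichotomy {N : ℕ} (c : Fin N → Fin N → ℕ) (d : ℕ) where
  vertices = allFin N

  -- The frequent colour is named through a vertex `u` at which it occurs, so the search over
  -- colours becomes finite. For `1 ≤ d` this misses no colour.
  Heavy : Fin N → Set
  Heavy x = ∃ λ u → d ≤ # (λ y → c x y ≟ c x u) vertices

  heavy? : Decidable Heavy
  heavy? x = Fin.any? (λ u → d ≤? # (λ y → c x y ≟ c x u) vertices)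

  lights : List (Fin N)
  lights = filter (λ x → ¬? (heavy? x)) vertices

  lights-unique : Unique lights
  lights-unique = Unique.filter⁺ (λ x → ¬? (heavy? x)) (Unique.allFin⁺ N)

  dominant : Fin N → ℕ
  dominant x with heavy? x
  ... | yes (u , _) = c x u
  -- A placeholder at light vertices; `X` is always chosen among heavy ones.
  ... | no  _       = 0

  dominant-heavy : ∀ {x} → Heavy x → d ≤ # (λ y → c x y ≟ dominant x) vertices
  dominant-heavy {x} h with heavy? x
  ... | yes (u , p) = p
  ... | no ¬h       = contradiction h ¬h

  -- If `κ` occurs at all, it is `c y u` for some `u`, and `d` occurrences would make `y` heavy with
  -- witness `u`. Restricting the count to `lights` only lowers it.
  light : ∀ {y} κ → y ∈ lights → # (λ u → κ ≟ c y u) lights ≤ d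
  light {y} κ y∈ with # (λ u → κ ≟ c y u) lights in e
  ... | zero  = z≤n
  ... | suc _ with #-witness (λ u → κ ≟ c y u) {lights} (≤-trans (s≤s z≤n) (≤-reflexive (sym e)))
  ...   | u , _ , refl = ≤-trans (≤-reflexive (sym e)) (≤-trans
            (≤-reflexive (#-filter-× (λ x → ¬? (heavy? x)) (λ v → c y u ≟ c y v) vertices))
            (≤-trans (#-mono (λ v → ¬? (heavy? v) ×-dec (c y u ≟ c y v)) (λ v → c y v ≟ c y u) vertices
                        λ _ (_ , p) → sym p)
              (<⇒≤ (≰⇒> λ p → proj₂ (∈-filter⁻ (λ x → ¬? (heavy? x)) {xs = vertices} y∈) (u , p)))))

-- Here `K` is the size of `X`, `L` a lower bound for the first set of the rich pair, and `s` and
-- `r` are the numbers of choices in the two rounds. The condition `2 * (K * K) ≤ N` ensures that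
-- with fewer than `K * K` heavy vertices at least half of all vertices are light.
canonicalCopy : ∀ {n t} (H : Graph n) → Bipartite H → Degenerate t H → 2 ≤ n →
  ∀ {N K d L} r s → 1 ≤ K → 1 ≤ d → 1 ≤ L → N ≡ n ^ 16 * d → 2 * (K * K) ≤ N →
  N ^ s * L + K * (K ^ (t + r) * n ^ s) ≤ K * d ^ s → N ^ t * n ^ r < L ^ r →
  ERProperty H N
canonicalCopy {n} {t} H bip@(side , proper) deg n≥2 {N} {K} {d} {L} r s K≥1 d≥1 L≥1 N≡ 2KK≤N size₁ size₂ (c , c-sym) =
  conclude (K * K ≤? # heavy? vertices)
  where
  open Dichotomy c d
  |vertices| : length vertices ≡ N
  |vertices| = length-tabulate (λ (i : Fin N) → i)

  rich : ∀ {X} → length X ≡ K → (∀ {x} → x ∈ X → Heavy x) →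
         TwoSided.RichPair (λ x y → c x y ≟ dominant x) n t X vertices
  rich {X} refl heavy = TwoSided.richPair (λ x y → c x y ≟ dominant x) n t r s
    (≤-trans (s≤s z≤n) (≤-trans (*-mono-≤ {2} {2} ≤-refl (*-mono-≤ K≥1 K≥1)) (≤-trans 2KK≤N (≤-reflexive (sym |vertices|)))))
    L≥1 (dominant-heavy ∘ heavy)
    (subst (λ m → m ^ s * L + K * (K ^ (t + r) * n ^ s) ≤ K * d ^ s) (sym |vertices|) size₁)
    (subst (λ m → m ^ t * n ^ r < L ^ r) (sym |vertices|) size₂)

  embed : ∀ {X} → Unique X → length X ≡ K → (∀ {x} → x ∈ X → Heavy x) → _
  embed uX len heavy = embedRichPair H bip deg Fin._≟_ (λ x y → c x y ≟ dominant x) uX (Unique.allFin⁺ N) (rich len heavy)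

  conclude : Dec (K * K ≤ # heavy? vertices) → Σ (Copy n N) λ φ → Canonical H c (proj₁ φ)
  conclude (yes many)
    with constantOrInjective dominant K K {filter heavy? vertices} (Unique.filter⁺ heavy? (Unique.allFin⁺ N))
           (≤-trans many (≤-reflexive (#-filter heavy? vertices)))
  ... | inj₁ (κ , X , len , uX , X⊆) =
    let φ , φ-inj , inX , adjacent = embed uX len (λ x∈ → proj₂ (∈-filter⁻ heavy? {xs = vertices} (proj₁ (All.lookup X⊆ x∈))))
    in (φ , φ-inj) , inj₁ (monochromatic H side proper c c-sym dominant φ-inj adjacent
                            λ v e → proj₂ (All.lookup X⊆ (inX v e)))
  ... | inj₂ (X , len , X⊆ , distinct) =
    let φ , φ-inj , inX , adjacent = embed (AllPairs.map (λ f≢ x≡y → f≢ (cong dominant x≡y)) distinct) len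
                                       (λ x∈ → proj₂ (∈-filter⁻ heavy? {xs = vertices} (All.lookup X⊆ x∈)))
    in (φ , φ-inj) , inj₂ (inj₂ (lexicographic H side proper c c-sym dominant φ-inj adjacent
                            λ u v eᵤ eᵥ → AllPairs-injective distinct (inX u eᵤ) (inX v eᵥ)))
  conclude (no few) =
    let φ , φ-inj , rainbow = RainbowClique.rainbowClique Fin._≟_ c c-sym lights-unique light n n≥2 d≥1 upper lower
    in (φ , φ-inj) , inj₂ (inj₁ λ i j k l e e′ → rainbow (distinct e) (distinct e′))
    where
    distinct : ∀ {i j} → Edge H i j → i ≢ j
    distinct {i} e refl with () ← trans (sym e) (irrefl H i)
    split : # heavy? vertices + length lights ≡ N
    split = trans (cong (# heavy? vertices +_) (sym (#-filter (λ x → ¬? (heavy? x)) vertices)))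
                  (trans (#-complement heavy? vertices) |vertices|)
    upper : length lights ≤ n ^ 16 * d
    upper = ≤-trans (m≤n+m _ _) (≤-reflexive (trans split N≡))
    lower : n ^ 16 * d ≤ 2 * length lights
    lower = subst (_≤ 2 * length lights) N≡ (+-cancelˡ-≤ N N _ (begin
      N + N                                      ≡⟨ cong (λ m → m + m) split ⟨
      (h + ℓ) + (h + ℓ)                          ≡⟨ double h ℓ ⟩
      2 * h + 2 * ℓ                              ≤⟨ +-monoˡ-≤ (2 * ℓ) (≤-trans (*-monoʳ-≤ 2 (<⇒≤ (≰⇒> few))) 2KK≤N) ⟩
      N + 2 * ℓ                                  ∎))
      where
      open ≤-Reasoning
      h = # heavy? vertices
      ℓ = length lights
      double : ∀ h ℓ → (h + ℓ) + (h + ℓ) ≡ 2 * h + 2 * ℓ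
      double = solve-∀

-- The trivial case `n = 1`, and parameters as powers of `n`.

singleVertex : (H : Graph 1) → ERProperty H 1
singleVertex H _ = (id , id) , inj₁ (0 , λ { zero zero e → contradiction (trans (sym e) (irrefl H zero)) λ () })

module Exponents {n t f : ℕ} (n≥2 : 2 ≤ n) (t≥1 : 1 ≤ t) (f≡ : f + 16 ≡ 203 * t) where
  instance
    n≢0 = >-nonZero (<⇒≤ n≥2)
    t≢0 = >-nonZero t≥1

  -- Each summand is at most half of `n ^ c`, because `2 ≤ n`.
  sum-of-powers : ∀ {a b c} → suc a ≤ c → suc b ≤ c → n ^ a + n ^ b ≤ n ^ c
  sum-of-powers {a} {b} {c} p q = *-cancelˡ-≤ 2 (begin
    2 * (n ^ a + n ^ b)       ≡⟨ *-distribˡ-+ 2 (n ^ a) (n ^ b) ⟩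
    2 * n ^ a + 2 * n ^ b     ≤⟨ +-mono-≤ (*-monoˡ-≤ (n ^ a) n≥2) (*-monoˡ-≤ (n ^ b) n≥2) ⟩
    n ^ suc a + n ^ suc b     ≤⟨ +-mono-≤ (^-monoʳ-≤ n p) (^-monoʳ-≤ n q) ⟩
    n ^ c + n ^ c             ≡⟨ cong (n ^ c +_) (+-identityʳ (n ^ c)) ⟨
    2 * n ^ c                 ∎)
    where open ≤-Reasoning

  split-N : n ^ (203 * t) ≡ n ^ 16 * n ^ f
  split-N = trans (cong (n ^_) (trans (sym f≡) (+-comm f 16))) (^-distribˡ-+-* n 16 f)

  halve : 2 * (n ^ (101 * t) * n ^ (101 * t)) ≤ n ^ (203 * t)
  halve = begin
    2 * (n ^ (101 * t) * n ^ (101 * t))   ≡⟨ cong (2 *_) (^-distribˡ-+-* n (101 * t) (101 * t)) ⟨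
    2 * n ^ (101 * t + 101 * t)           ≤⟨ *-monoˡ-≤ _ n≥2 ⟩
    n ^ suc (101 * t + 101 * t)           ≤⟨ ^-monoʳ-≤ n (≤-trans (+-monoˡ-≤ _ t≥1) (≤-reflexive (total t))) ⟩
    n ^ (203 * t)                         ∎
    where
    open ≤-Reasoning
    total : ∀ t → t + (101 * t + 101 * t) ≡ 203 * t
    total = solve-∀

  -- With `f = 203 * t - 16` the exponent on the right is `609 t² + 53 t`. The summands on the left
  -- have exponents `609 t² + 52 t` and `505 t² + 104 t`, both strictly smaller as `1 ≤ t`.
  first-step : (n ^ (203 * t)) ^ (3 * t) * n ^ (52 * t)
               + n ^ (101 * t) * ((n ^ (101 * t)) ^ (t + 4 * t) * n ^ (3 * t))
               ≤ n ^ (101 * t) * (n ^ f) ^ (3 * t)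
  first-step = subst₂ _≤_ (cong₂ _+_ (sym left) (sym middle)) (sym right) (sum-of-powers smaller₁ smaller₂)
    where
    left : (n ^ (203 * t)) ^ (3 * t) * n ^ (52 * t) ≡ n ^ (203 * t * (3 * t) + 52 * t)
    left = trans (cong (_* n ^ (52 * t)) (^-*-assoc n (203 * t) (3 * t))) (sym (^-distribˡ-+-* n (203 * t * (3 * t)) (52 * t)))
    middle : n ^ (101 * t) * ((n ^ (101 * t)) ^ (t + 4 * t) * n ^ (3 * t))
             ≡ n ^ (101 * t + (101 * t * (t + 4 * t) + 3 * t))
    middle = trans (cong (n ^ (101 * t) *_)
        (trans (cong (_* n ^ (3 * t)) (^-*-assoc n (101 * t) (t + 4 * t)))
               (sym (^-distribˡ-+-* n (101 * t * (t + 4 * t)) (3 * t)))))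
      (sym (^-distribˡ-+-* n (101 * t) (101 * t * (t + 4 * t) + 3 * t)))
    right : n ^ (101 * t) * (n ^ f) ^ (3 * t) ≡ n ^ (101 * t + f * (3 * t))
    right = trans (cong (n ^ (101 * t) *_) (^-*-assoc n f (3 * t))) (sym (^-distribˡ-+-* n (101 * t) (f * (3 * t))))
    smaller₁ : suc (203 * t * (3 * t) + 52 * t) ≤ 101 * t + f * (3 * t)
    smaller₁ = begin
      suc (203 * t * (3 * t) + 52 * t)          ≤⟨ +-monoˡ-≤ _ t≥1 ⟩
      t + (203 * t * (3 * t) + 52 * t)          ≡⟨ cong (λ e → t + (e * (3 * t) + 52 * t)) f≡ ⟨
      t + ((f + 16) * (3 * t) + 52 * t)         ≡⟨ expand f t ⟩
      101 * t + f * (3 * t)                     ∎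
      where
      open ≤-Reasoning
      expand : ∀ f t → t + ((f + 16) * (3 * t) + 52 * t) ≡ 101 * t + f * (3 * t)
      expand = solve-∀
    smaller₂ : suc (101 * t + (101 * t * (t + 4 * t) + 3 * t)) ≤ 101 * t + f * (3 * t)
    -- Adding `48 * t`, which is `16 * (3 * t)`, completes `f` to `203 * t` and avoids subtraction.
    smaller₂ = +-cancelʳ-≤ (48 * t) _ _ (begin
      suc (101 * t + (101 * t * (t + 4 * t) + 3 * t)) + 48 * t
        ≤⟨ +-monoˡ-≤ (48 * t) (+-monoˡ-≤ _ t≥1) ⟩
      t + (101 * t + (101 * t * (t + 4 * t) + 3 * t)) + 48 * t
        ≡⟨ expand t ⟩
      101 * t + 505 * (t * t) + 52 * t
        ≤⟨ +-monoʳ-≤ (101 * t + 505 * (t * t)) (*-mono-≤ (m≤m+n 52 52) (m≤m*n t t)) ⟩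
      101 * t + 505 * (t * t) + 104 * (t * t)
        ≡⟨ collect t ⟩
      101 * t + 203 * t * (3 * t)
        ≡⟨ cong (λ e → 101 * t + e * (3 * t)) f≡ ⟨
      101 * t + (f + 16) * (3 * t)
        ≡⟨ separate f t ⟩
      101 * t + f * (3 * t) + 48 * t  ∎)
      where
      open ≤-Reasoning
      expand : ∀ t → t + (101 * t + (101 * t * (t + 4 * t) + 3 * t)) + 48 * t ≡ 101 * t + 505 * (t * t) + 52 * t
      expand = solve-∀
      collect : ∀ t → 101 * t + 505 * (t * t) + 104 * (t * t) ≡ 101 * t + 203 * t * (3 * t)
      collect = solve-∀
      separate : ∀ f t → 101 * t + (f + 16) * (3 * t) ≡ 101 * t + f * (3 * t) + 48 * t
      separate = solve-∀

  -- The union bound for the second round, on exponents: `203 t² + 4 t ≤ 207 t² < 208 t²`.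
  second-step : (n ^ (203 * t)) ^ t * n ^ (4 * t) < (n ^ (52 * t)) ^ (4 * t)
  second-step = subst₂ _<_
    (trans (^-distribˡ-+-* n (203 * t * t) (4 * t)) (cong (_* n ^ (4 * t)) (sym (^-*-assoc n (203 * t) t))))
    (sym (^-*-assoc n (52 * t) (4 * t)))
    (^-monoʳ-< n n≥2 (begin-strict
      203 * t * t + 4 * t        ≤⟨ +-mono-≤ (≤-reflexive (*-assoc 203 t t)) (*-monoʳ-≤ 4 (m≤m*n t t)) ⟩
      203 * (t * t) + 4 * (t * t) ≡⟨ collect t ⟩
      207 * (t * t)              <⟨ *-monoˡ-< (t * t) {{>-nonZero (*-mono-≤ t≥1 t≥1)}} (n<1+n 207) ⟩
      208 * (t * t)              ≡⟨ separate t ⟩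
      52 * t * (4 * t)           ∎))
    where
    open ≤-Reasoning
    collect : ∀ t → 203 * (t * t) + 4 * (t * t) ≡ 207 * (t * t)
    collect = solve-∀
    separate : ∀ t → 208 * (t * t) ≡ 52 * t * (4 * t)
    separate = solve-∀

theorem2p1 : ∃ λ (C : ℕ) → ∀ (n t : ℕ) → 1 ≤ n → 1 ≤ t →
    (H : Graph n) → Bipartite H → Degenerate t H → ER≤ H (n ^ (C * t))
theorem2p1 = 203 , bound
  where
  bound : ∀ n t → 1 ≤ n → 1 ≤ t → (H : Graph n) → Bipartite H → Degenerate t H → ER≤ H (n ^ (203 * t))
  -- Powers of `1` do not grow, so the estimates start at `n = 2`; a single vertex has no edges.
  bound 1 t _ _ H _ _ = 1 , m^n>0 1 (203 * t) , singleVertex H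
  bound n@(suc (suc _)) t _ t≥1 H bip deg = n ^ (203 * t) , ≤-refl ,
    -- `K * K` has exponent `202 * t`, leaving a factor `n ^ t ≥ 2` below `N`; `d` is `N` divided by
    -- `n ^ 16`. The last two numbers are `r` and `s`.
    canonicalCopy H bip deg n≥2 {K = n ^ (101 * t)} {d = n ^ (203 * t ∸ 16)} {L = n ^ (52 * t)} (4 * t) (3 * t)
      (m^n>0 n (101 * t)) (m^n>0 n (203 * t ∸ 16)) (m^n>0 n (52 * t))
      split-N halve first-step second-step
    where
    n≥2 : 2 ≤ n
    n≥2 = s≤s (s≤s z≤n)
    open Exponents {n} {t} n≥2 t≥1 (m∸n+n≡m (≤-trans (m≤m+n 16 187) (*-monoʳ-≤ 203 t≥1)))
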